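{- Let $(\Sigma,\Pi)$ be a first-order signature over a variable system with the de Bruijn property and $T$ a theory over it. Then the Lindenbaum–Tarski structure $\mathcal H_{\Sigma,\Pi,T}=(\mathcal F_\Sigma,\mathrm{Pr}_{\Sigma,\Pi,T},\forall,\exists)$ is a first-order hyperdoctrine over $\mathcal F_\Sigma$, and it has the universal model property: $(\Gamma,\phi)\le(\Gamma,\psi)$ in $\mathrm{Pr}_{\Sigma,\Pi,T}(\Gamma)$ if and only if $(\phi\Rightarrow_\Gamma\psi)\in\mathrm{Thm}(\Sigma,\Pi,T)$.
   Context: Type system: fix an infinite set $V$ of variables with decidable equality and a fresh variable provider: functions $\varphi,\mathsf{fr}$ assigning to each finite $X\subseteq V$ an inhabited $\varphi(X)\subseteq V\setminus X$ and $\mathsf{fr}(X)\in\varphi(X)$; de Bruijn property: $\varphi(X)=\{\mathsf{fr}(X)\}$. Disjoint sets $F$ (function symbols), $T$ (type symbols). Preelements: terms from variables and $F$; pretypes $S(t_1,\ldots,t_n)$, $S\in T$. $\mathrm V(E)$: variables of $E$; $E[\bar a/\bar x]$: simultaneous substitution. Precontext $\Gamma=x_1:A_1,\ldots,x_n:A_n$ with $x_k\in\varphi(\{x_1,\ldots,x_{k-1}\})$, $\mathrm V(A_k)\subseteq\{x_1,\ldots,x_{k-1}\}$; $\mathrm{OV}(\Gamma)=x_1,\ldots,x_n$; $\mathrm{Fresh}(\Gamma)=\varphi(\mathrm V(\Gamma))$, $\mathrm{fresh}(\Gamma)=\mathsf{fr}(\mathrm V(\Gamma))$; $E[\bar a/\Gamma]=E[\bar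 a/x_1,\ldots,x_n]$. Top variables $\mathrm{TV}(\langle\rangle)=\emptyset$, $\mathrm{TV}(\Gamma,x:A)=(\mathrm{TV}(\Gamma)\setminus\mathrm V(A))\cup\{x\}$; a determining sequence is a strictly increasing $\bar i=i_1,\ldots,i_k$ with $\mathrm{TV}(\Gamma)\subseteq\{x_{i_1},\ldots,x_{i_k}\}$, $\bar a_{\bar i}=a_{i_1},\ldots,a_{i_k}$. Declarations $(\Gamma,S,\bar i)$ and $(\Gamma,f,\bar i,U)$ ($\mathrm V(U)\subseteq\mathrm V(\Gamma)$), each symbol at most once. $\mathcal J(\Sigma)$: smallest set of judgements closed under (R1) $\langle\rangle$ context; (R2) $\Gamma$ context, $A$ type $(\Gamma)$ $\Rightarrow$ $\Gamma,x:A$ context ($x\in\mathrm{Fresh}(\Gamma)$); (R3) $x_1:A_1,\ldots,x_n:A_n$ context $\Rightarrow$ $x_i:A_i\ (x_1:A_1,\ldots,x_n:A_n)$; (R4) $(\Gamma,S,\bar i)\in\Sigma$, $\bar a:\Delta\to\Gamma$ $\Rightarrow$ $S(\bar a_{\bar i})$ type $(\Delta)$; (R5) $(\Gamma,f,\bar i,U)\in\Sigma$, $\bar a:\Delta\to\Gamma$, $U[\bar a/\Gamma]$ type $(\Delta)$ $\Rightarrow$ $f(\bar a_{\bar i}):U[\bar a/\Gamma]\ (\Delta)$; where "$\bar a:\Delta\to\Gamma$" abbreviates $\Delta$ context, $\Gamma$ context, $a_k:A_k[a_1,\ldots,a_{k-1}/x_1,\ldots,x_{k-1}]\ (\Delta)$.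 $\Sigma$ is a signature if declared contexts are contexts and declared $U$ are types in $\mathcal J(\Sigma)$. Cwf: a category $\mathcal C$ with terminal object; classes $\mathrm{Ty}(\Gamma)$ with functorial substitution $A\{f\}$; context extension $\Gamma.A$ with $\mathrm p(A):\Gamma.A\to\Gamma$; classes $\mathrm{Tm}(\Gamma,A)$ with functorial $a\{f\}\in\mathrm{Tm}(\Delta,A\{f\})$; $\mathrm v_A\in\mathrm{Tm}(\Gamma.A,A\{\mathrm p(A)\})$; $\langle f,a\rangle_A:\Delta\to\Gamma.A$ for $a\in\mathrm{Tm}(\Delta,A\{f\})$ with $\mathrm p(A)\langle f,a\rangle_A=f$, $\mathrm v_A\{\langle f,a\rangle_A\}=a$, $\langle\mathrm p(A)h,\mathrm v_A\{h\}\rangle_A=h$, $\langle f,a\rangle_A g=\langle fg,a\{g\}\rangle_A$; $f.A=\langle f\circ\mathrm p(A\{f\}),\mathrm v_{A\{f\}}\rangle_A:\Delta.A\{f\}\to\Gamma.A$. The cwf $\mathcal F_\Sigma$: objects are contexts $\Gamma$ (i.e. ($\Gamma$ context)$\in\mathcal J(\Sigma)$); morphisms $(\Delta,\Gamma,\bar a)$ with $\bar a:\Delta\to\Gamma$ in $\mathcal J(\Sigma)$, composed by substitution, identity $(\Gamma,\Gamma,\mathrm{OV}(\Gamma))$; $\mathrm{Ty}(\Gamma)=\{(\Gamma,A):(A\text{ type }(\Gamma))\in\mathcal J(\Sigma)\}$, $(\Gamma,A)\{(\Delta,\Gamma,\bar a)\}=(\Delta,A[\bar a/\Gamma])$; $\mathrm{Tm}(\Gamma,(\Gamma,A))=\{((\Gamma,A),a):(a:A\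 (\Gamma))\in\mathcal J(\Sigma)\}$; $\Gamma.(\Gamma,S)=\langle\Gamma,\mathrm{fresh}(\Gamma):S\rangle$, $\mathrm p=(\Gamma.(\Gamma,S),\Gamma,\mathrm{OV}(\Gamma))$, $\mathrm v=((\Gamma.(\Gamma,S),S),\mathrm{fresh}(\Gamma))$, $\langle(\Delta,\Gamma,\bar s),((\Delta,S[\bar s/\Gamma]),b)\rangle=(\Delta,\Gamma.(\Gamma,S),(\bar s,b))$. Heyting (pre)algebra: a preorder $\le$ (not necessarily antisymmetric) with $\top,\bot,\wedge,\vee,\to$ satisfying $\bot\le x\le\top$, $z\le x\wedge y$ iff $z\le x$ and $z\le y$, $x\vee y\le z$ iff $x\le z$ and $y\le z$, $z\le(x\to y)$ iff $z\wedge x\le y$; morphisms are monotone maps preserving the operations and constants. A first-order hyperdoctrine over a cwf $\mathcal C$ is $(\mathcal C,\mathrm{Pr},\forall,\exists)$ with $\mathrm{Pr}:\mathcal C^{\mathrm{op}}\to\mathrm{Heyting}$ a functor ($R\{f\}=\mathrm{Pr}(f)(R)$) and, for $S\in\mathrm{Ty}(\Gamma)$, monotone $\forall_S,\exists_S:\mathrm{Pr}(\Gamma.S)\to\mathrm{Pr}(\Gamma)$ with $Q\le\forall_S(R)$ iff $Q\{\mathrm p(S)\}\le R$, and $\exists_S(R)\le Q$ iff $R\le Q\{\mathrm p(S)\}$ ($Q\in\mathrm{Pr}(\Gamma)$, $R\in\mathrm{Pr}(\Gamma.S)$), and for $f:\Delta\to\Gamma$: $\forall_S(R)\{f\}=\forall_{S\{f\}}(R\{f.S\})$,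 $\exists_S(R)\{f\}=\exists_{S\{f\}}(R\{f.S\})$. Logic: predicate symbols from a set $P$ disjoint from $F\cup T$; a predicate declaration is $(\Gamma,\bar i,R)$ with ($\Gamma$ context)$\in\mathcal J(\Sigma)$, $\bar i$ determining, $R\in P$; a predicate signature $\Pi$ declares each symbol at most once. $\mathrm{Form}(\Sigma,\Pi)$ is the smallest set of judgements "$\phi$ form $(\Gamma)$" with: $R(\bar a_{\bar i})$ form $(\Delta)$ for $(\Gamma,\bar i,R)\in\Pi$ and $\bar a:\Delta\to\Gamma$ in $\mathcal J(\Sigma)$; $\bot,\top$ form $(\Gamma)$ for contexts $\Gamma$; $(\phi\circ\psi)$ form $(\Gamma)$ for $\circ\in\{\wedge,\vee,\to\}$ from $\phi,\psi$ form $(\Gamma)$; $(Qx:A)\phi$ form $(\Gamma)$ for $Q\in\{\forall,\exists\}$ from $\phi$ form $(\Gamma,x:A)$ (with $(A\text{ type }(\Gamma))\in\mathcal J(\Sigma)$). Capture-avoiding substitution for $\bar a:\Delta\to\Gamma$: $\phi\{(\Delta,\Gamma,\bar a)\}=\phi[\bar a/\Gamma]$ for atomic $\phi$; it commutes with $\top,\bot,\wedge,\vee,\to$; and $((Qx:A)\theta)\{(\Delta,\Gamma,\bar a)\}=(Qy:A[\bar a/\Gamma])\,\theta\{(\langle\Delta,y:A[\bar a/\Gamma]\rangle,\langle\Gamma,x:A\rangle,(\bar a,y))\}$ with $y=\mathrm{fresh}(\Delta)$. A sequent is $\phi\Rightarrow_\Gamma\psi$ with $\phi,\psi$ form $(\Gamma)$;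 a theory is a set of sequents. Write $\mathbf p_\Gamma(x:A)=(\langle\Gamma,x:A\rangle,\Gamma,\mathrm{OV}(\Gamma))$. $\mathrm{Thm}(\Sigma,\Pi,T)$ is the smallest set of sequents containing $T$ and closed under: $\phi\Rightarrow_\Gamma\phi$; cut (from $\phi\Rightarrow_\Gamma\theta$, $\theta\Rightarrow_\Gamma\psi$ infer $\phi\Rightarrow_\Gamma\psi$); $\theta\wedge\psi\Rightarrow_\Gamma\theta$, $\theta\wedge\psi\Rightarrow_\Gamma\psi$, from $\phi\Rightarrow_\Gamma\theta$, $\phi\Rightarrow_\Gamma\psi$ infer $\phi\Rightarrow_\Gamma\theta\wedge\psi$, $\phi\Rightarrow_\Gamma\top$; $\theta\Rightarrow_\Gamma\theta\vee\psi$, $\psi\Rightarrow_\Gamma\theta\vee\psi$, from $\theta\Rightarrow_\Gamma\phi$, $\psi\Rightarrow_\Gamma\phi$ infer $\theta\vee\psi\Rightarrow_\Gamma\phi$, $\bot\Rightarrow_\Gamma\phi$; $\theta\wedge\psi\Rightarrow_\Gamma\phi$ iff $\theta\Rightarrow_\Gamma\psi\to\phi$ (both directions as rules); $\phi\{\mathbf p_\Gamma(x:A)\}\Rightarrow_{\Gamma,x:A}\psi$ iff $\phi\Rightarrow_\Gamma(\forall x:A)\psi$ (both directions); $\psi\Rightarrow_{\Gamma,x:A}\phi\{\mathbf p_\Gamma(x:A)\}$ iff $(\exists x:A)\psi\Rightarrow_\Gamma\phi$ (both directions); and substitution: from $\phi\Rightarrow_\Gamma\psi$ and $\bar a:\Delta\to\Gamma$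 in $\mathcal J(\Sigma)$ infer $\phi\{(\Delta,\Gamma,\bar a)\}\Rightarrow_\Delta\psi\{(\Delta,\Gamma,\bar a)\}$. Lindenbaum–Tarski structure: $\mathrm{Pr}_{\Sigma,\Pi,T}(\Gamma)=\{(\Gamma,\phi):(\phi\text{ form }(\Gamma))\in\mathrm{Form}(\Sigma,\Pi)\}$ ordered by $(\Gamma,\phi)\le(\Gamma,\psi)$ iff $(\phi\Rightarrow_\Gamma\psi)\in\mathrm{Thm}(\Sigma,\Pi,T)$, with Heyting operations given by the connectives; $\mathrm{Pr}((\Delta,\Gamma,\bar a))(\Gamma,\phi)=(\Delta,\phi\{(\Delta,\Gamma,\bar a)\})$; $\forall_{(\Gamma,A)}(\langle\Gamma,x:A\rangle,\psi)=(\Gamma,(\forall x:A)\psi)$ and $\exists_{(\Gamma,A)}(\langle\Gamma,x:A\rangle,\psi)=(\Gamma,(\exists x:A)\psi)$. -}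

module Defs where

open import Data.Empty using (⊥-elim)
open import Data.Fin as Fin using (Fin; opposite)
open import Data.Irrelevant as Irr using (Irrelevant) renaming ([_] to irr)
open import Data.List as List using (List; []; _∷_; _++_)
open import Data.List.Membership.Propositional using (_∈_; _∉_)
open import Data.List.Membership.Propositional.Properties using (∈-++⁺ˡ; ∈-++⁺ʳ; ∈-++⁻)
open import Data.List.Relation.Binary.Subset.Propositional using (_⊆_)
open import Data.List.Relation.Unary.All as All using (All)
open import Data.List.Relation.Unary.Any using (here; there)
open import Data.List.Relation.Unary.Linked using (Linked)
import Data.List.Membership.DecPropositional as DecMembership
open import Data.Nat using (ℕ; zero; suc)
open import Data.Product using (_×_; _,_; proj₁; proj₂)
open import Data.Refinement using (Refinement; value; proof)
open import Data.Sum using ([_,_]′)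
open import Data.Unit using (⊤; tt)
open import Data.Vec as Vec using (Vec; []; _∷_; toList)
import Data.Vec.Membership.Propositional as VecMembership
open import Data.Vec.Properties using (lookup-map; map-cong; map-id)
open import Data.Vec.Relation.Unary.Any using (here; there)
open import Function using (_⇔_; id; _∘_)
open import Level using (Level; _⊔_; 0ℓ) renaming (suc to lsuc)
open import Relation.Binary using (IsPreorder; DecidableEquality)
open import Relation.Binary.PropositionalEquality
  using (_≡_; _≢_; refl; sym; trans; cong; cong₂; subst; subst₂)
open import Relation.Nullary using (Dec; yes; no; ¬?; recompute)
open import Relation.Nullary.Decidable using (_×-dec_; map′)
open import Relation.Unary using (Pred; _≐_; ｛_｝)

private variable
  o h t m p r : Level

record Category (o h : Level) : Set (lsuc (o ⊔ h)) where
  infixr 9 _∘ᶜ_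
  field
    Ob   : Set o
    Hom  : Ob → Ob → Set h
    idᶜ  : ∀ {Γ} → Hom Γ Γ
    _∘ᶜ_ : ∀ {Θ Δ Γ} → Hom Δ Γ → Hom Θ Δ → Hom Θ Γ
    identityˡ : ∀ {Δ Γ} (f : Hom Δ Γ) → idᶜ ∘ᶜ f ≡ f
    identityʳ : ∀ {Δ Γ} (f : Hom Δ Γ) → f ∘ᶜ idᶜ ≡ f
    assoc : ∀ {Ξ Θ Δ Γ} (f : Hom Δ Γ) (g : Hom Θ Δ) (k : Hom Ξ Θ) →
            (f ∘ᶜ g) ∘ᶜ k ≡ f ∘ᶜ (g ∘ᶜ k)

-- The occurrences of `subst` only transport along the functoriality of
-- type substitution, which is left implicit on paper.
record Cwf (o h t m : Level) : Set (lsuc (o ⊔ h ⊔ t ⊔ m)) where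
  infixl 8 _[_] _⟦_⟧
  infixl 6 _▹_
  field
    category : Category o h
  open Category category public
  field
    ⟨⟩       : Ob
    !        : ∀ {Γ} → Hom Γ ⟨⟩
    !-unique : ∀ {Γ} (f : Hom Γ ⟨⟩) → f ≡ !

    Ty   : Ob → Set t
    _[_] : ∀ {Δ Γ} → Ty Γ → Hom Δ Γ → Ty Δ
    []-id : ∀ {Γ} {A : Ty Γ} → A [ idᶜ ] ≡ A
    []-∘  : ∀ {Θ Δ Γ} {A : Ty Γ} {f : Hom Δ Γ} {g : Hom Θ Δ} →
            A [ f ∘ᶜ g ] ≡ A [ f ] [ g ]

    Tm   : (Γ : Ob) → Ty Γ → Set m
    _⟦_⟧ : ∀ {Δ Γ} {A : Ty Γ} → Tm Γ A → (f : Hom Δ Γ) → Tm Δ (A [ f ])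
    ⟦⟧-id : ∀ {Γ} {A : Ty Γ} (a : Tm Γ A) → subst (Tm Γ) []-id (a ⟦ idᶜ ⟧) ≡ a
    ⟦⟧-∘  : ∀ {Θ Δ Γ} {A : Ty Γ} (a : Tm Γ A) (f : Hom Δ Γ) (g : Hom Θ Δ) →
            subst (Tm Θ) []-∘ (a ⟦ f ∘ᶜ g ⟧) ≡ a ⟦ f ⟧ ⟦ g ⟧

    _▹_  : (Γ : Ob) → Ty Γ → Ob
    𝐩    : ∀ {Γ} (A : Ty Γ) → Hom (Γ ▹ A) Γ
    𝐯    : ∀ {Γ} (A : Ty Γ) → Tm (Γ ▹ A) (A [ 𝐩 A ])
    pair : ∀ {Δ Γ} (A : Ty Γ) (f : Hom Δ Γ) → Tm Δ (A [ f ]) → Hom Δ (Γ ▹ A)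

    𝐩-pair : ∀ {Δ Γ} {A : Ty Γ} {f : Hom Δ Γ} {a : Tm Δ (A [ f ])} →
             𝐩 A ∘ᶜ pair A f a ≡ f
    𝐯-pair : ∀ {Δ Γ} {A : Ty Γ} {f : Hom Δ Γ} {a : Tm Δ (A [ f ])} →
             subst (Tm Δ) (trans (sym []-∘) (cong (A [_]) 𝐩-pair)) (𝐯 A ⟦ pair A f a ⟧) ≡ a
    pair-η : ∀ {Δ Γ} {A : Ty Γ} (k : Hom Δ (Γ ▹ A)) →
             pair A (𝐩 A ∘ᶜ k) (subst (Tm Δ) (sym []-∘) (𝐯 A ⟦ k ⟧)) ≡ k
    pair-∘ : ∀ {Θ Δ Γ} {A : Ty Γ} (f : Hom Δ Γ) (a : Tm Δ (A [ f ])) (g : Hom Θ Δ) →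
             pair A f a ∘ᶜ g ≡ pair A (f ∘ᶜ g) (subst (Tm Θ) (sym []-∘) (a ⟦ g ⟧))

  -- f.A : Δ.A{f} → Γ.A
  lift : ∀ {Δ Γ} (f : Hom Δ Γ) (A : Ty Γ) → Hom (Δ ▹ A [ f ]) (Γ ▹ A)
  lift f A = pair A (f ∘ᶜ 𝐩 (A [ f ])) (subst (Tm _) (sym []-∘) (𝐯 (A [ f ])))

record RawHeyting (p r : Level) : Set (lsuc (p ⊔ r)) where
  infix  4 _≤_
  infixr 7 _∧_
  infixr 6 _∨_
  infixr 5 _⇒_
  field
    Carrier     : Set p
    _≤_         : Carrier → Carrier → Set r
    ⊤ʰ ⊥ʰ       : Carrier
    _∧_ _∨_ _⇒_ : Carrier → Carrier → Carrier

record IsHeytingPrealgebra (H : RawHeyting p r) : Set (p ⊔ r) where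
  open RawHeyting H
  field
    isPreorder : IsPreorder _≡_ _≤_
    ⊥-least    : ∀ x → ⊥ʰ ≤ x
    ⊤-greatest : ∀ x → x ≤ ⊤ʰ
    ∧-meet     : ∀ x y z → z ≤ x ∧ y ⇔ (z ≤ x × z ≤ y)
    ∨-join     : ∀ x y z → x ∨ y ≤ z ⇔ (x ≤ z × y ≤ z)
    ⇒-residual : ∀ x y z → z ≤ (x ⇒ y) ⇔ z ∧ x ≤ y

record IsHeytingMorphism (H K : RawHeyting p r)
    (f : RawHeyting.Carrier H → RawHeyting.Carrier K) : Set (p ⊔ r) where
  private
    module H = RawHeyting H
    module K = RawHeyting K
  field
    monotone : ∀ {x y} → x H.≤ y → f x K.≤ f y
    ⊤-homo   : f H.⊤ʰ ≡ K.⊤ʰ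
    ⊥-homo   : f H.⊥ʰ ≡ K.⊥ʰ
    ∧-homo   : ∀ x y → f (x H.∧ y) ≡ f x K.∧ f y
    ∨-homo   : ∀ x y → f (x H.∨ y) ≡ f x K.∨ f y
    ⇒-homo   : ∀ x y → f (x H.⇒ y) ≡ (f x K.⇒ f y)

-- The data (Pr, ∀, ∃) over a cwf, without the laws.
record RawHyperdoctrine (C : Cwf o h t m) (p r : Level)
    : Set (o ⊔ h ⊔ t ⊔ lsuc (p ⊔ r)) where
  open Cwf C
  infixl 8 _﹛_﹜
  field
    Pr : Ob → RawHeyting p r
  module Pr (Γ : Ob) = RawHeyting (Pr Γ)
  field
    _﹛_﹜  : ∀ {Δ Γ} → Pr.Carrier Γ → Hom Δ Γ → Pr.Carrier Δ
    ∀ʰ ∃ʰ : ∀ {Γ} (S : Ty Γ) → Pr.Carrier (Γ ▹ S) → Pr.Carrier Γ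

record IsFirstOrderHyperdoctrine {C : Cwf o h t m} (D : RawHyperdoctrine C p r)
    : Set (o ⊔ h ⊔ t ⊔ p ⊔ r) where
  open Cwf C
  open RawHyperdoctrine D
  private
    infix 4 _≤_
    _≤_ : ∀ {Γ} → Pr.Carrier Γ → Pr.Carrier Γ → Set r
    _≤_ {Γ} = Pr._≤_ Γ
  field
    Pr-heyting  : ∀ Γ → IsHeytingPrealgebra (Pr Γ)
    Pr-morphism : ∀ {Δ Γ} (f : Hom Δ Γ) → IsHeytingMorphism (Pr Γ) (Pr Δ) (_﹛ f ﹜)
    Pr-id       : ∀ {Γ} (R : Pr.Carrier Γ) → R ﹛ idᶜ ﹜ ≡ R
    Pr-∘        : ∀ {Θ Δ Γ} (R : Pr.Carrier Γ) (f : Hom Δ Γ) (g : Hom Θ Δ) →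
                  R ﹛ f ∘ᶜ g ﹜ ≡ R ﹛ f ﹜ ﹛ g ﹜

    ∀-monotone : ∀ {Γ} {S : Ty Γ} {R R′ : Pr.Carrier (Γ ▹ S)} → R ≤ R′ → ∀ʰ S R ≤ ∀ʰ S R′
    ∃-monotone : ∀ {Γ} {S : Ty Γ} {R R′ : Pr.Carrier (Γ ▹ S)} → R ≤ R′ → ∃ʰ S R ≤ ∃ʰ S R′
    ∀-adjoint  : ∀ {Γ} {S : Ty Γ} (Q : Pr.Carrier Γ) (R : Pr.Carrier (Γ ▹ S)) →
                 Q ≤ ∀ʰ S R ⇔ Q ﹛ 𝐩 S ﹜ ≤ R
    ∃-adjoint  : ∀ {Γ} {S : Ty Γ} (Q : Pr.Carrier Γ) (R : Pr.Carrier (Γ ▹ S)) →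
                 ∃ʰ S R ≤ Q ⇔ R ≤ Q ﹛ 𝐩 S ﹜
    ∀-stable   : ∀ {Δ Γ} {S : Ty Γ} (R : Pr.Carrier (Γ ▹ S)) (f : Hom Δ Γ) →
                 (∀ʰ S R) ﹛ f ﹜ ≡ ∀ʰ (S [ f ]) (R ﹛ lift f S ﹜)
    ∃-stable   : ∀ {Δ Γ} {S : Ty Γ} (R : Pr.Carrier (Γ ▹ S)) (f : Hom Δ Γ) →
                 (∃ʰ S R) ﹛ f ﹜ ≡ ∃ʰ (S [ f ]) (R ﹛ lift f S ﹜)

-- Finite subsets of V are given by lists, and `fr` and `φ` depend only on the
-- set of members of a list.  V is infinite, since fr X ∉ X for every X.
record VariableSystem : Set₁ where
  infix 4 _≟_
  field
    V       : Set
    _≟_     : DecidableEquality V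
    φ       : List V → Pred V 0ℓ
    fr      : List V → V
    φ-ext   : ∀ {X Y} → X ⊆ Y → Y ⊆ X → φ X ≐ φ Y
    fr-ext  : ∀ {X Y} → X ⊆ Y → Y ⊆ X → fr X ≡ fr Y
    φ-fresh : ∀ {X x} → φ X x → x ∉ X
    fr-φ    : ∀ X → φ X (fr X)

DeBruijn : VariableSystem → Set
DeBruijn 𝓥 = ∀ X → φ X ≐ ｛ fr X ｝
  where open VariableSystem 𝓥

-- Sequences a₁, …, aₙ (of terms, variables, declarations) are vectors stored
-- with the last component at the head, so that (ā , b) is ā ▸ b.
infixl 5 _▸_
pattern _▸_ xs x = x ∷ xs

-- ā_ī for a sequence ī of (zero-based) indices; `opposite` undoes the reversed
-- storage.
infix 6 _at_
_at_ : ∀ {a} {A : Set a} {n} → Vec A n → List (Fin n) → List A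
xs at ī = List.map (λ i → Vec.lookup xs (opposite i)) ī

module _ (𝓥 : VariableSystem) (F T : Set) where
  open VariableSystem 𝓥
  open DecMembership _≟_ using (_∈?_)

  data Term : Set where
    var : V → Term
    fn  : F → List Term → Term

  data PreType : Set where
    ty : T → List Term → PreType

  vars  : Term → List V
  vars* : List Term → List V
  vars (var x)   = x ∷ []
  vars (fn _ ts) = vars* ts
  vars* []       = []
  vars* (t ∷ ts) = vars t ++ vars* ts

  varsᵀ : PreType → List V
  varsᵀ (ty _ ts) = vars* ts

  infixl 8 _⟪_⟫ _⟪_⟫* _⟪_⟫ᵀ
  _⟪_⟫  : Term → (V → Term) → Term
  _⟪_⟫* : List Term → (V → Term) → List Term
  var x   ⟪ σ ⟫  = σ x
  fn f ts ⟪ σ ⟫  = fn f (ts ⟪ σ ⟫*)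
  []       ⟪ σ ⟫* = []
  (t ∷ ts) ⟪ σ ⟫* = t ⟪ σ ⟫ ∷ ts ⟪ σ ⟫*

  _⟪_⟫ᵀ : PreType → (V → Term) → PreType
  ty S ts ⟪ σ ⟫ᵀ = ty S (ts ⟪ σ ⟫*)

  -- E ⟪ ā / x̄ ⟫ is the simultaneous substitution E[ā/x̄].
  infix 4 _/_
  _/_ : ∀ {n} → Vec Term n → Vec V n → V → Term
  ([]    / [])    y = var y
  (ā ▸ a / x̄ ▸ x) y with y ≟ x
  ... | yes _ = a
  ... | no  _ = (ā / x̄) y

  PreCtx : ℕ → Set
  PreCtx n = Vec (V × PreType) n

  OV : ∀ {n} → PreCtx n → Vec V n
  OV = Vec.map proj₁

  -- V(Γ), as x₁,…,xₙ already comprise the variables of A₁,…,Aₙ.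
  Vars : ∀ {n} → PreCtx n → List V
  Vars Γ = toList (OV Γ)

  IsPrecontext : ∀ {n} → PreCtx n → Set
  IsPrecontext []            = ⊤
  IsPrecontext (Γ ▸ (x , A)) = IsPrecontext Γ × φ (Vars Γ) x × varsᵀ A ⊆ Vars Γ

  TV : ∀ {n} → PreCtx n → List V
  TV []            = []
  TV (Γ ▸ (x , A)) = x ∷ List.filter (λ y → ¬? (y ∈? varsᵀ A)) (TV Γ)

  Determining : ∀ {n} → PreCtx n → List (Fin n) → Set
  Determining Γ ī = Linked Fin._<_ ī × TV Γ ⊆ OV Γ at ī

  record TypeDecl : Set where
    field
      {size} : ℕ
      ctx    : PreCtx size
      symbol : T
      idx    : List (Fin size)

  record FunDecl : Set where
    field
      {size} : ℕ
      ctx    : PreCtx size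
      symbol : F
      idx    : List (Fin size)
      res    : PreType

  record Presignature : Set₁ where
    field
      types : Pred TypeDecl 0ℓ
      funs  : Pred FunDecl 0ℓ

      type-ctx    : ∀ {d} → types d → IsPrecontext (TypeDecl.ctx d)
      type-idx    : ∀ {d} → types d → Determining (TypeDecl.ctx d) (TypeDecl.idx d)
      type-unique : ∀ {d e} → types d → types e → TypeDecl.symbol d ≡ TypeDecl.symbol e → d ≡ e

      fun-ctx    : ∀ {d} → funs d → IsPrecontext (FunDecl.ctx d)
      fun-idx    : ∀ {d} → funs d → Determining (FunDecl.ctx d) (FunDecl.idx d)
      fun-res    : ∀ {d} → funs d → varsᵀ (FunDecl.res d) ⊆ Vars (FunDecl.ctx d)
      fun-unique : ∀ {d e} → funs d → funs e → FunDecl.symbol d ≡ FunDecl.symbol e → d ≡ e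

  module _ (𝓢 : Presignature) where
    open Presignature 𝓢
    open VecMembership using () renaming (_∈_ to _∈ᵛ_)

    -- Derivability in 𝒥(Σ) of  Γ context,  A type (Γ),  a : A (Γ)  and  ā : Δ → Γ;
    -- `Components Δ Γ ā` is the family of judgements aₖ : Aₖ[a₁,…,aₖ₋₁/x₁,…,xₖ₋₁] (Δ).
    data Context    : ∀ {n} → PreCtx n → Set
    data IsType     : ∀ {n} → PreCtx n → PreType → Set
    data IsElem     : ∀ {n} → PreCtx n → Term → PreType → Set
    data IsMor      : ∀ {k n} → PreCtx k → PreCtx n → Vec Term n → Set
    data Components : ∀ {k n} → PreCtx k → PreCtx n → Vec Term n → Set

    infixl 5 _▸ᶜ_
    data Context where
      R1 : Context []
      R2 : ∀ {n} {Γ : PreCtx n} {x A} →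
           Context Γ → IsType Γ A → φ (Vars Γ) x → Context (Γ ▸ (x , A))

    data IsType where
      R4 : ∀ {k} {Δ : PreCtx k} {d ā} →
           types d → IsMor Δ (TypeDecl.ctx d) ā →
           IsType Δ (ty (TypeDecl.symbol d) (ā at TypeDecl.idx d))

    data IsElem where
      R3 : ∀ {n} {Γ : PreCtx n} {x A} → Context Γ → (x , A) ∈ᵛ Γ → IsElem Γ (var x) A
      R5 : ∀ {k} {Δ : PreCtx k} {d ā} →
           funs d → IsMor Δ (FunDecl.ctx d) ā →
           IsType Δ (FunDecl.res d ⟪ ā / OV (FunDecl.ctx d) ⟫ᵀ) →
           IsElem Δ (fn (FunDecl.symbol d) (ā at FunDecl.idx d))
                    (FunDecl.res d ⟪ ā / OV (FunDecl.ctx d) ⟫ᵀ)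

    data IsMor where
      mor : ∀ {k n} {Δ : PreCtx k} {Γ : PreCtx n} {ā} →
            Context Δ → Context Γ → Components Δ Γ ā → IsMor Δ Γ ā

    data Components where
      []   : ∀ {k} {Δ : PreCtx k} → Components Δ [] []
      _▸ᶜ_ : ∀ {k n} {Δ : PreCtx k} {Γ : PreCtx n} {ā x A a} →
             Components Δ Γ ā → IsElem Δ a (A ⟪ ā / OV Γ ⟫ᵀ) →
             Components Δ (Γ ▸ (x , A)) (ā ▸ a)

  record Signature : Set₁ where
    field
      presignature : Presignature
    open Presignature presignature public
    field
      type-context : ∀ {d} → types d → Context presignature (TypeDecl.ctx d)
      fun-context  : ∀ {d} → funs d → Context presignature (FunDecl.ctx d)
      fun-type     : ∀ {d} → funs d → IsType presignature (FunDecl.ctx d) (FunDecl.res d)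

  ⟪⟫-cong : ∀ t {σ τ} → (∀ {y} → y ∈ vars t → σ y ≡ τ y) → t ⟪ σ ⟫ ≡ t ⟪ τ ⟫
  ⟪⟫*-cong : ∀ ts {σ τ} → (∀ {y} → y ∈ vars* ts → σ y ≡ τ y) → ts ⟪ σ ⟫* ≡ ts ⟪ τ ⟫*
  ⟪⟫-cong (var x)   eq = eq (here refl)
  ⟪⟫-cong (fn f ts) eq = cong (fn f) (⟪⟫*-cong ts eq)
  ⟪⟫*-cong []       eq = refl
  ⟪⟫*-cong (t ∷ ts) eq =
    cong₂ _∷_ (⟪⟫-cong t (eq ∘ ∈-++⁺ˡ)) (⟪⟫*-cong ts (eq ∘ ∈-++⁺ʳ (vars t)))

  ⟪⟫ᵀ-cong : ∀ A {σ τ} → (∀ {y} → y ∈ varsᵀ A → σ y ≡ τ y) → A ⟪ σ ⟫ᵀ ≡ A ⟪ τ ⟫ᵀ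
  ⟪⟫ᵀ-cong (ty S ts) eq = cong (ty S) (⟪⟫*-cong ts eq)

  ⟪⟫-var : ∀ t → t ⟪ var ⟫ ≡ t
  ⟪⟫*-var : ∀ ts → ts ⟪ var ⟫* ≡ ts
  ⟪⟫-var (var x)   = refl
  ⟪⟫-var (fn f ts) = cong (fn f) (⟪⟫*-var ts)
  ⟪⟫*-var []       = refl
  ⟪⟫*-var (t ∷ ts) = cong₂ _∷_ (⟪⟫-var t) (⟪⟫*-var ts)

  ⟪⟫-∘ : ∀ t {σ τ} → t ⟪ σ ⟫ ⟪ τ ⟫ ≡ t ⟪ (λ y → σ y ⟪ τ ⟫) ⟫
  ⟪⟫*-∘ : ∀ ts {σ τ} → ts ⟪ σ ⟫* ⟪ τ ⟫* ≡ ts ⟪ (λ y → σ y ⟪ τ ⟫) ⟫*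
  ⟪⟫-∘ (var x)   = refl
  ⟪⟫-∘ (fn f ts) = cong (fn f) (⟪⟫*-∘ ts)
  ⟪⟫*-∘ []       = refl
  ⟪⟫*-∘ (t ∷ ts) = cong₂ _∷_ (⟪⟫-∘ t) (⟪⟫*-∘ ts)

  ids : ∀ {n} → Vec V n → Vec Term n
  ids = Vec.map var

  infixl 8 _⟪_⟫ᵛ
  _⟪_⟫ᵛ : ∀ {n} → Vec Term n → (V → Term) → Vec Term n
  ā ⟪ σ ⟫ᵛ = Vec.map (_⟪ σ ⟫) ā

  at-⟪⟫ : ∀ {n} (ā : Vec Term n) ī σ → (ā at ī) ⟪ σ ⟫* ≡ (ā ⟪ σ ⟫ᵛ) at ī
  at-⟪⟫ ā []      σ = refl
  at-⟪⟫ ā (i ∷ ī) σ = cong₂ _∷_ (sym (lookup-map (opposite i) (_⟪ σ ⟫) ā)) (at-⟪⟫ ā ī σ)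

  /-ids : ∀ {n} (x̄ : Vec V n) y → (ids x̄ / x̄) y ≡ var y
  /-ids []      y = refl
  /-ids (x̄ ▸ x) y with y ≟ x
  ... | yes refl = refl
  ... | no  _    = /-ids x̄ y

  /-here : ∀ {n} (ā : Vec Term n) x̄ a x → (ā ▸ a / x̄ ▸ x) x ≡ a
  /-here ā x̄ a x with x ≟ x
  ... | yes _   = refl
  ... | no  x≢x = ⊥-elim (x≢x refl)

  /-there : ∀ {n} (ā : Vec Term n) x̄ a {x y} → y ≢ x → (ā ▸ a / x̄ ▸ x) y ≡ (ā / x̄) y
  /-there ā x̄ a {x} {y} y≢x with y ≟ x
  ... | yes y≡x = ⊥-elim (y≢x y≡x)
  ... | no  _   = refl

  /-∘ : ∀ {n} (ā : Vec Term n) x̄ σ {y} → y ∈ toList x̄ → (ā / x̄) y ⟪ σ ⟫ ≡ (ā ⟪ σ ⟫ᵛ / x̄) y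
  /-∘ (ā ▸ a) (x̄ ▸ x) σ {y} y∈ with y ≟ x
  /-∘ (ā ▸ a) (x̄ ▸ x) σ {y} y∈         | yes _   = refl
  /-∘ (ā ▸ a) (x̄ ▸ x) σ {y} (here y≡x) | no  y≢x = ⊥-elim (y≢x y≡x)
  /-∘ (ā ▸ a) (x̄ ▸ x) σ {y} (there y∈) | no  _   = /-∘ ā x̄ σ y∈

  ∉⇒≢ : ∀ {x y : V} {X Y} → Y ⊆ X → x ∉ X → y ∈ Y → y ≢ x
  ∉⇒≢ Y⊆X x∉X y∈Y refl = x∉X (Y⊆X y∈Y)

  ⟪ids⟫ : ∀ {n} t (x̄ : Vec V n) → t ⟪ ids x̄ / x̄ ⟫ ≡ t
  ⟪ids⟫ t x̄ = trans (⟪⟫-cong t (λ {y} _ → /-ids x̄ y)) (⟪⟫-var t)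

  ⟪ids⟫* : ∀ {n} ts (x̄ : Vec V n) → ts ⟪ ids x̄ / x̄ ⟫* ≡ ts
  ⟪ids⟫* ts x̄ = trans (⟪⟫*-cong ts (λ {y} _ → /-ids x̄ y)) (⟪⟫*-var ts)

  ⟪ids⟫ᵀ : ∀ {n} A (x̄ : Vec V n) → A ⟪ ids x̄ / x̄ ⟫ᵀ ≡ A
  ⟪ids⟫ᵀ (ty S ts) x̄ = cong (ty S) (⟪ids⟫* ts x̄)

  ⟪ids⟫ᵛ : ∀ {n k} (ā : Vec Term k) (x̄ : Vec V n) → ā ⟪ ids x̄ / x̄ ⟫ᵛ ≡ ā
  ⟪ids⟫ᵛ ā x̄ = trans (map-cong (λ t → ⟪ids⟫ t x̄) ā) (map-id ā)

  ⟪/⟫-∘ : ∀ {n} t (ā : Vec Term n) x̄ σ → vars t ⊆ toList x̄ →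
          t ⟪ ā / x̄ ⟫ ⟪ σ ⟫ ≡ t ⟪ ā ⟪ σ ⟫ᵛ / x̄ ⟫
  ⟪/⟫-∘ t ā x̄ σ t⊆ = trans (⟪⟫-∘ t) (⟪⟫-cong t (/-∘ ā x̄ σ ∘ t⊆))

  ⟪/⟫*-∘ : ∀ {n} ts (ā : Vec Term n) x̄ σ → vars* ts ⊆ toList x̄ →
           ts ⟪ ā / x̄ ⟫* ⟪ σ ⟫* ≡ ts ⟪ ā ⟪ σ ⟫ᵛ / x̄ ⟫*
  ⟪/⟫*-∘ ts ā x̄ σ ts⊆ = trans (⟪⟫*-∘ ts) (⟪⟫*-cong ts (/-∘ ā x̄ σ ∘ ts⊆))

  ⟪/⟫ᵀ-∘ : ∀ {n} A (ā : Vec Term n) x̄ σ → varsᵀ A ⊆ toList x̄ →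
           A ⟪ ā / x̄ ⟫ᵀ ⟪ σ ⟫ᵀ ≡ A ⟪ ā ⟪ σ ⟫ᵛ / x̄ ⟫ᵀ
  ⟪/⟫ᵀ-∘ (ty S ts) ā x̄ σ A⊆ = cong (ty S) (⟪/⟫*-∘ ts ā x̄ σ A⊆)

  ⟪/⟫ᵀ-wk : ∀ {n} A (ā : Vec Term n) x̄ a {x} → varsᵀ A ⊆ toList x̄ → x ∉ toList x̄ →
            A ⟪ ā ▸ a / x̄ ▸ x ⟫ᵀ ≡ A ⟪ ā / x̄ ⟫ᵀ
  ⟪/⟫ᵀ-wk A ā x̄ a A⊆ x∉ = ⟪⟫ᵀ-cong A (λ y∈ → /-there ā x̄ a (∉⇒≢ A⊆ x∉ y∈))

  VarsIn : ∀ {n} → Vec Term n → List V → Set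
  VarsIn []      X = ⊤
  VarsIn (ā ▸ a) X = VarsIn ā X × vars a ⊆ X

  ⟪/⟫ᵛ-∘ : ∀ {n k} (s̄ : Vec Term k) (ā : Vec Term n) x̄ σ → VarsIn s̄ (toList x̄) →
           s̄ ⟪ ā / x̄ ⟫ᵛ ⟪ σ ⟫ᵛ ≡ s̄ ⟪ ā ⟪ σ ⟫ᵛ / x̄ ⟫ᵛ
  ⟪/⟫ᵛ-∘ []      ā x̄ σ _          = refl
  ⟪/⟫ᵛ-∘ (s̄ ▸ s) ā x̄ σ (s̄⊆ , s⊆) = cong₂ (λ s̄ s → s̄ ▸ s) (⟪/⟫ᵛ-∘ s̄ ā x̄ σ s̄⊆) (⟪/⟫-∘ s ā x̄ σ s⊆)

  ⟪/⟫ᵛ-wk : ∀ {n k} (s̄ : Vec Term k) (ā : Vec Term n) x̄ a {x} →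
            VarsIn s̄ (toList x̄) → x ∉ toList x̄ → s̄ ⟪ ā ▸ a / x̄ ▸ x ⟫ᵛ ≡ s̄ ⟪ ā / x̄ ⟫ᵛ
  ⟪/⟫ᵛ-wk []      ā x̄ a _         x∉ = refl
  ⟪/⟫ᵛ-wk (s̄ ▸ s) ā x̄ a (s̄⊆ , s⊆) x∉ =
    cong₂ (λ s̄ s → s̄ ▸ s) (⟪/⟫ᵛ-wk s̄ ā x̄ a s̄⊆ x∉)
          (⟪⟫-cong s (λ y∈ → /-there ā x̄ a (∉⇒≢ s⊆ x∉ y∈)))

  Distinct : ∀ {n} → Vec V n → Set
  Distinct []      = ⊤
  Distinct (x̄ ▸ x) = Distinct x̄ × x ∉ toList x̄

  ids-⊆ : ∀ {n} (x̄ : Vec V n) {X} → toList x̄ ⊆ X → VarsIn (ids x̄) X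
  ids-⊆ []      x̄⊆ = tt
  ids-⊆ (x̄ ▸ x) x̄⊆ = ids-⊆ x̄ (x̄⊆ ∘ there) , λ { (here refl) → x̄⊆ (here refl) }

  ids-/ : ∀ {n} (ā : Vec Term n) x̄ → Distinct x̄ → ids x̄ ⟪ ā / x̄ ⟫ᵛ ≡ ā
  ids-/ []      []      _         = refl
  ids-/ (ā ▸ a) (x̄ ▸ x) (x̄! , x∉) =
    cong₂ (λ s̄ s → s̄ ▸ s)
          (trans (⟪/⟫ᵛ-wk (ids x̄) ā x̄ a (ids-⊆ x̄ id) x∉) (ids-/ ā x̄ x̄!))
          (/-here ā x̄ a x)

  -- Derivability proofs below are irrelevant, but these consequences of them
  -- are decidable and can be recomputed.
  _⊆?_ : (X Y : List V) → Dec (X ⊆ Y)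
  X ⊆? Y = map′ All.lookup All.tabulate (All.all? (_∈? Y) X)

  varsIn? : ∀ {n} (ā : Vec Term n) X → Dec (VarsIn ā X)
  varsIn? []      X = yes tt
  varsIn? (ā ▸ a) X = varsIn? ā X ×-dec (vars a ⊆? X)

  distinct? : ∀ {n} (x̄ : Vec V n) → Dec (Distinct x̄)
  distinct? []      = yes tt
  distinct? (x̄ ▸ x) = distinct? x̄ ×-dec ¬? (x ∈? toList x̄)

  module _ {𝓢 : Presignature} where
    open Presignature 𝓢
    open VecMembership using () renaming (_∈_ to _∈ᵛ_)

    at-vars : ∀ {n} (ā : Vec Term n) ī {X} → VarsIn ā X → vars* (ā at ī) ⊆ X
    at-vars ā []      ā⊆ ()
    at-vars ā (i ∷ ī) ā⊆ = [ lookup⊆ ā (opposite i) ā⊆ , at-vars ā ī ā⊆ ]′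
                           ∘ ∈-++⁻ (vars (Vec.lookup ā (opposite i)))
      where
      lookup⊆ : ∀ {n} (ā : Vec Term n) i {X} → VarsIn ā X → vars (Vec.lookup ā i) ⊆ X
      lookup⊆ (ā ▸ a) Fin.zero    (_  , a⊆) = a⊆
      lookup⊆ (ā ▸ a) (Fin.suc i) (ā⊆ , _)  = lookup⊆ ā i ā⊆

    ∈⇒∈Vars : ∀ {n} {Γ : PreCtx n} {x A} → (x , A) ∈ᵛ Γ → x ∈ Vars Γ
    ∈⇒∈Vars (here refl) = here refl
    ∈⇒∈Vars (there d∈)  = there (∈⇒∈Vars d∈)

    components-vars : ∀ {k n} {Δ : PreCtx k} {Γ : PreCtx n} {ā} →
                      Components 𝓢 Δ Γ ā → VarsIn ā (Vars Δ)
    type-vars : ∀ {n} {Γ : PreCtx n} {A} → IsType 𝓢 Γ A → varsᵀ A ⊆ Vars Γ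
    elem-vars : ∀ {n} {Γ : PreCtx n} {a A} → IsElem 𝓢 Γ a A → vars a ⊆ Vars Γ
    components-vars []         = tt
    components-vars (āok ▸ᶜ aok) = components-vars āok , elem-vars aok
    type-vars (R4 {d = d} {ā} _ (mor _ _ āok)) = at-vars ā (TypeDecl.idx d) (components-vars āok)
    elem-vars (R3 _ d∈) (here refl) = ∈⇒∈Vars d∈
    elem-vars (R5 {d = d} {ā} _ (mor _ _ āok) _) =
      at-vars ā (FunDecl.idx d) (components-vars āok)

    mor-vars : ∀ {k n} {Δ : PreCtx k} {Γ : PreCtx n} {ā} →
               IsMor 𝓢 Δ Γ ā → VarsIn ā (Vars Δ)
    mor-vars (mor _ _ āok) = components-vars āok

    context-distinct : ∀ {n} {Γ : PreCtx n} → Context 𝓢 Γ → Distinct (OV Γ)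
    context-distinct R1             = tt
    context-distinct (R2 Γok _ x∈φ) = context-distinct Γok , φ-fresh x∈φ

    entry-vars : ∀ {n} {Γ : PreCtx n} {x A} → Context 𝓢 Γ → (x , A) ∈ᵛ Γ → varsᵀ A ⊆ Vars Γ
    entry-vars (R2 _ Aok _)  (here refl) = there ∘ type-vars Aok
    entry-vars (R2 Γok _ _)  (there d∈)  = there ∘ entry-vars Γok d∈

    entry-sub : ∀ {k n} {Θ : PreCtx k} {Γ : PreCtx n} {b̄ x A} →
                Context 𝓢 Γ → Components 𝓢 Θ Γ b̄ → (x , A) ∈ᵛ Γ →
                IsElem 𝓢 Θ ((b̄ / OV Γ) x) (A ⟪ b̄ / OV Γ ⟫ᵀ)
    entry-sub {Θ = Θ} {Γ ▸ (x , A)} {b̄ ▸ b} (R2 Γok Aok x∈φ) (b̄ok ▸ᶜ bok) (here refl) =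
      subst₂ (IsElem 𝓢 Θ) (sym (/-here b̄ (OV Γ) b x))
             (sym (⟪/⟫ᵀ-wk A b̄ (OV Γ) b (type-vars Aok) (φ-fresh x∈φ))) bok
    entry-sub {Θ = Θ} {Γ ▸ (x , A)} {b̄ ▸ b} {A = B} (R2 Γok Aok x∈φ) (b̄ok ▸ᶜ _) (there d∈) =
      subst₂ (IsElem 𝓢 Θ)
             (sym (/-there b̄ (OV Γ) b (∉⇒≢ id (φ-fresh x∈φ) (∈⇒∈Vars d∈))))
             (sym (⟪/⟫ᵀ-wk B b̄ (OV Γ) b (entry-vars Γok d∈) (φ-fresh x∈φ)))
             (entry-sub Γok b̄ok d∈)

    type-sub : ∀ {k n} {Θ : PreCtx k} {Δ : PreCtx n} {b̄ A} →
               IsType 𝓢 Δ A → IsMor 𝓢 Θ Δ b̄ → IsType 𝓢 Θ (A ⟪ b̄ / OV Δ ⟫ᵀ)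
    elem-sub : ∀ {k n} {Θ : PreCtx k} {Δ : PreCtx n} {b̄ a A} →
               IsElem 𝓢 Δ a A → IsMor 𝓢 Θ Δ b̄ →
               IsElem 𝓢 Θ (a ⟪ b̄ / OV Δ ⟫) (A ⟪ b̄ / OV Δ ⟫ᵀ)
    components-sub : ∀ {k n l} {Θ : PreCtx k} {Δ : PreCtx n} {Γ : PreCtx l} {ā b̄} →
                     Context 𝓢 Γ → Components 𝓢 Δ Γ ā → IsMor 𝓢 Θ Δ b̄ →
                     Components 𝓢 Θ Γ (ā ⟪ b̄ / OV Δ ⟫ᵛ)
    mor-sub : ∀ {k n l} {Θ : PreCtx k} {Δ : PreCtx n} {Γ : PreCtx l} {ā b̄} →
              IsMor 𝓢 Δ Γ ā → IsMor 𝓢 Θ Δ b̄ → IsMor 𝓢 Θ Γ (ā ⟪ b̄ / OV Δ ⟫ᵛ)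
    type-sub {Θ = Θ} {Δ} {b̄} (R4 {d = d} {ā} d∈ āok) b̄ok =
      subst (λ ts → IsType 𝓢 Θ (ty (TypeDecl.symbol d) ts))
            (sym (at-⟪⟫ ā (TypeDecl.idx d) (b̄ / OV Δ)))
            (R4 d∈ (mor-sub āok b̄ok))
    elem-sub (R3 Δok d∈) (mor _ _ b̄ok) = entry-sub Δok b̄ok d∈
    elem-sub {Θ = Θ} {Δ} {b̄} (R5 {d = d} {ā} d∈ āok Uok) b̄ok =
      subst₂ (λ ts → IsElem 𝓢 Θ (fn (FunDecl.symbol d) ts))
             (sym (at-⟪⟫ ā (FunDecl.idx d) (b̄ / OV Δ))) (sym U≡)
             (R5 d∈ (mor-sub āok b̄ok) (subst (IsType 𝓢 Θ) U≡ (type-sub Uok b̄ok)))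
      where U≡ = ⟪/⟫ᵀ-∘ (FunDecl.res d) ā (OV (FunDecl.ctx d)) (b̄ / OV Δ) (fun-res d∈)
    components-sub _ [] _ = []
    components-sub {Θ = Θ} {Δ} {Γ ▸ (x , A)} {ā ▸ a} {b̄} (R2 Γok Aok _) (āok ▸ᶜ aok) b̄ok =
      components-sub Γok āok b̄ok
      ▸ᶜ subst (IsElem 𝓢 Θ _) (⟪/⟫ᵀ-∘ A ā (OV Γ) (b̄ / OV Δ) (type-vars Aok)) (elem-sub aok b̄ok)
    mor-sub (mor _ Γok āok) b̄ok@(mor Θok _ _) = mor Θok Γok (components-sub Γok āok b̄ok)

    components-ids : ∀ {k n} {Δ : PreCtx k} (Γ : PreCtx n) → Context 𝓢 Δ →
                     (∀ {d} → d ∈ᵛ Γ → d ∈ᵛ Δ) → Components 𝓢 Δ Γ (ids (OV Γ))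
    components-ids []            Δok Γ⊆ = []
    components-ids (Γ ▸ (x , A)) Δok Γ⊆ =
      components-ids Γ Δok (Γ⊆ ∘ there)
      ▸ᶜ subst (IsElem 𝓢 _ (var x)) (sym (⟪ids⟫ᵀ A (OV Γ))) (R3 Δok (Γ⊆ (here refl)))

    mor-id : ∀ {n} {Γ : PreCtx n} → Context 𝓢 Γ → IsMor 𝓢 Γ Γ (ids (OV Γ))
    mor-id {Γ = Γ} Γok = mor Γok Γok (components-ids Γ Γok id)

    mor-proj : ∀ {n} {Γ : PreCtx n} {d} → Context 𝓢 (Γ ▸ d) → IsMor 𝓢 (Γ ▸ d) Γ (ids (OV Γ))
    mor-proj {Γ = Γ} Γdok@(R2 Γok _ _) = mor Γdok Γok (components-ids Γ Γdok there)

    mor-pair : ∀ {k n} {Δ : PreCtx k} {Γ : PreCtx n} {ā x A a} →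
               IsMor 𝓢 Δ Γ ā → Context 𝓢 (Γ ▸ (x , A)) → IsElem 𝓢 Δ a (A ⟪ ā / OV Γ ⟫ᵀ) →
               IsMor 𝓢 Δ (Γ ▸ (x , A)) (ā ▸ a)
    mor-pair (mor Δok _ āok) Γxok aok = mor Δok Γxok (āok ▸ᶜ aok)

    mor-wk : ∀ {k n} {Δ : PreCtx k} {Γ : PreCtx n} {ā d} →
             IsMor 𝓢 Δ Γ ā → Context 𝓢 (Δ ▸ d) → IsMor 𝓢 (Δ ▸ d) Γ ā
    mor-wk {Δ = Δ} {Γ} {ā} {d} āok Δdok =
      subst (IsMor 𝓢 (Δ ▸ d) Γ) (⟪ids⟫ᵛ ā (OV Δ)) (mor-sub āok (mor-proj Δdok))

    mor-lift : ∀ {k n} {Δ : PreCtx k} {Γ : PreCtx n} {ā x A} →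
               IsMor 𝓢 Δ Γ ā → Context 𝓢 (Γ ▸ (x , A)) →
               let y = fr (Vars Δ) in
               IsMor 𝓢 (Δ ▸ (y , A ⟪ ā / OV Γ ⟫ᵀ)) (Γ ▸ (x , A)) (ā ▸ var y)
    mor-lift {Δ = Δ} āok@(mor Δok _ _) Γxok@(R2 _ Aok _) =
      mor-pair (mor-wk āok Δyok) Γxok (R3 Δyok (here refl))
      where Δyok = R2 Δok (type-sub Aok āok) (fr-φ (Vars Δ))

  -- Judgements form a set, so objects, morphisms, types and elements are equal
  -- as soon as the underlying syntax is: derivations are irrelevant.
  module _ (Sg : Signature) where
    open Signature Sg using () renaming (presignature to 𝓢)

    record Ctx : Set where
      constructor mkCtx
      field
        {size} : ℕ
        raw    : PreCtx size
        ok     : Irrelevant (Context 𝓢 raw)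
    open Ctx

    record Mor (Δ Γ : Ctx) : Set where
      constructor mor
      field
        raw : Vec Term (Ctx.size Γ)
        ok  : Irrelevant (IsMor 𝓢 (Ctx.raw Δ) (Ctx.raw Γ) raw)
    open Mor

    record Type (Γ : Ctx) : Set where
      constructor type
      field
        raw : PreType
        ok  : Irrelevant (IsType 𝓢 (Ctx.raw Γ) raw)
    open Type

    record Elem (Γ : Ctx) (A : Type Γ) : Set where
      constructor elem
      field
        raw : Term
        ok  : Irrelevant (IsElem 𝓢 (Ctx.raw Γ) raw (Type.raw A))
    open Elem

    FreshVar : Ctx → Set
    FreshVar Γ = Refinement V (φ (Vars (Γ .raw)))

    fresh : (Γ : Ctx) → FreshVar Γ
    fresh Γ = record { value = fr X ; proof = irr (fr-φ X) }
      where X = Vars (Γ .raw)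

    extend : (Γ : Ctx) → FreshVar Γ → Type Γ → Ctx
    extend Γ x A = mkCtx (Γ .raw ▸ (x .value , A .raw)) ⦇ R2 (Γ .ok) (A .ok) (x .proof) ⦈
      where open Irr using (pure; _<*>_)

    projection : (Γ : Ctx) (x : FreshVar Γ) (A : Type Γ) → Mor (extend Γ x A) Γ
    projection Γ x A = mor (ids (OV (Γ .raw))) (Irr.map mor-proj (extend Γ x A .ok))

    idMor : ∀ {Γ} → Mor Γ Γ
    idMor {Γ} = mor (ids (OV (Γ .raw))) (Irr.map mor-id (Γ .ok))

    infixr 9 _⊙_
    _⊙_ : ∀ {Θ Δ Γ} → Mor Δ Γ → Mor Θ Δ → Mor Θ Γ
    _⊙_ {Δ = Δ} f g = mor (f .raw ⟪ g .raw / OV (Δ .raw) ⟫ᵛ) (Irr.zipWith mor-sub (f .ok) (g .ok))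

    infixl 8 _[_]ᵀ _[_]ᵉ
    _[_]ᵀ : ∀ {Δ Γ} → Type Γ → Mor Δ Γ → Type Δ
    _[_]ᵀ {Γ = Γ} A f = type (A .raw ⟪ f .raw / OV (Γ .raw) ⟫ᵀ) (Irr.zipWith type-sub (A .ok) (f .ok))

    _[_]ᵉ : ∀ {Δ Γ} {A : Type Γ} → Elem Γ A → (f : Mor Δ Γ) → Elem Δ (A [ f ]ᵀ)
    _[_]ᵉ {Γ = Γ} a f = elem (a .raw ⟪ f .raw / OV (Γ .raw) ⟫) (Irr.zipWith elem-sub (a .ok) (f .ok))

    lastVar : ∀ {Γ} (A : Type Γ) →
              Elem (extend Γ (fresh Γ) A) (A [ projection Γ (fresh Γ) A ]ᵀ)
    lastVar {Γ} A = elem (var (fr (Vars (Γ .raw)))) (Irr.map derivation (extend Γ (fresh Γ) A .ok))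
      where
      derivation : Context 𝓢 (extend Γ (fresh Γ) A .raw) → IsElem 𝓢 _ _ _
      derivation Γxok = subst (IsElem 𝓢 _ _) (sym (⟪ids⟫ᵀ (A .raw) (OV (Γ .raw))))
                              (R3 Γxok (here refl))

    pairMor : ∀ {Δ Γ} (A : Type Γ) (f : Mor Δ Γ) → Elem Δ (A [ f ]ᵀ) →
              Mor Δ (extend Γ (fresh Γ) A)
    pairMor {Γ = Γ} A f a = mor (f .raw ▸ a .raw)
      ⦇ mor-pair (f .ok) (extend Γ (fresh Γ) A .ok) (a .ok) ⦈
      where open Irr using (pure; _<*>_)

    Mor-≡ : ∀ {Δ Γ} {f g : Mor Δ Γ} → f .raw ≡ g .raw → f ≡ g
    Mor-≡ {f = mor _ _} {mor _ _} refl = refl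

    Type-≡ : ∀ {Γ} {A B : Type Γ} → A .raw ≡ B .raw → A ≡ B
    Type-≡ {A = type _ _} {type _ _} refl = refl

    Elem-≡ : ∀ {Γ} {A : Type Γ} {a b : Elem Γ A} → a .raw ≡ b .raw → a ≡ b
    Elem-≡ {a = elem _ _} {elem _ _} refl = refl

    raw-subst : ∀ {Γ} {A B : Type Γ} (eq : A ≡ B) (a : Elem Γ A) →
                subst (Elem Γ) eq a .raw ≡ a .raw
    raw-subst refl a = refl

    subst-≡ : ∀ {Γ} {A B : Type Γ} (eq : A ≡ B) {a : Elem Γ A} {b : Elem Γ B} →
              a .raw ≡ b .raw → subst (Elem Γ) eq a ≡ b
    subst-≡ refl = Elem-≡

    Ctx-distinct : (Γ : Ctx) → Distinct (OV (Γ .raw))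
    Ctx-distinct (mkCtx Γ (irr Γok)) = recompute (distinct? (OV Γ)) (context-distinct Γok)

    Type-vars : ∀ {Γ} (A : Type Γ) → varsᵀ (A .raw) ⊆ Vars (Γ .raw)
    Type-vars {Γ} (type A (irr Aok)) = recompute (varsᵀ A ⊆? Vars (Γ .raw)) (type-vars Aok)

    Elem-vars : ∀ {Γ} {A : Type Γ} (a : Elem Γ A) → vars (a .raw) ⊆ Vars (Γ .raw)
    Elem-vars {Γ} (elem a (irr aok)) = recompute (vars a ⊆? Vars (Γ .raw)) (elem-vars aok)

    Mor-vars : ∀ {Δ Γ} (f : Mor Δ Γ) → VarsIn (f .raw) (Vars (Δ .raw))
    Mor-vars {Δ} (mor f (irr fok)) = recompute (varsIn? f (Vars (Δ .raw))) (mor-vars fok)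

    fresh-∉ : (Γ : Ctx) → value (fresh Γ) ∉ Vars (Γ .raw)
    fresh-∉ Γ = φ-fresh (fr-φ (Vars (Γ .raw)))

    [⊙]ᵀ : ∀ {Θ Δ Γ} (A : Type Γ) (f : Mor Δ Γ) (g : Mor Θ Δ) →
           A [ f ⊙ g ]ᵀ ≡ A [ f ]ᵀ [ g ]ᵀ
    [⊙]ᵀ {Δ = Δ} {Γ} A f g = Type-≡ (sym
      (⟪/⟫ᵀ-∘ (A .raw) (f .raw) (OV (Γ .raw)) (g .raw / OV (Δ .raw)) (Type-vars A)))

    private
      proj∘pair : ∀ {Δ Γ} (A : Type Γ) (f : Mor Δ Γ) (a : Elem Δ (A [ f ]ᵀ)) →
                  ids (OV (Γ .raw)) ⟪ f .raw ▸ a .raw / OV (Γ .raw) ▸ fresh Γ .value ⟫ᵛ ≡ f .raw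
      proj∘pair {Γ = Γ} A f a =
        trans (⟪/⟫ᵛ-wk (ids x̄) (f .raw) x̄ (a .raw) (ids-⊆ x̄ id) (fresh-∉ Γ))
              (ids-/ (f .raw) x̄ (Ctx-distinct Γ))
        where x̄ = OV (Γ .raw)

    𝓕 : Cwf 0ℓ 0ℓ 0ℓ 0ℓ
    𝓕 = record
      { category = record
        { Ob = Ctx
        ; Hom = Mor
        ; idᶜ = idMor
        ; _∘ᶜ_ = _⊙_
        ; identityˡ = λ {_} {Γ} f → Mor-≡ (ids-/ (f .raw) (OV (Γ .raw)) (Ctx-distinct Γ))
        ; identityʳ = λ {Δ} f → Mor-≡ (⟪ids⟫ᵛ (f .raw) (OV (Δ .raw)))
        ; assoc = λ {_} {Θ} {Δ} f g k →
            Mor-≡ (⟪/⟫ᵛ-∘ (f .raw) (g .raw) (OV (Δ .raw)) (k .raw / OV (Θ .raw)) (Mor-vars f))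
        }
      ; ⟨⟩ = mkCtx [] (irr R1)
      ; ! = λ {Γ} → mor [] (Irr.map (λ Γok → mor Γok R1 []) (Γ .ok))
      ; !-unique = λ { (mor [] _) → refl }
      ; Ty = Type
      ; _[_] = _[_]ᵀ
      ; []-id = λ {Γ} {A} → Type-≡ (⟪ids⟫ᵀ (A .raw) (OV (Γ .raw)))
      ; []-∘ = λ {_} {_} {_} {A} {f} {g} → [⊙]ᵀ A f g
      ; Tm = Elem
      ; _⟦_⟧ = _[_]ᵉ
      ; ⟦⟧-id = λ {Γ} a → subst-≡ _ (⟪ids⟫ (a .raw) (OV (Γ .raw)))
      ; ⟦⟧-∘ = λ {_} {Δ} {Γ} {A} a f g → subst-≡ ([⊙]ᵀ A f g) (sym
          (⟪/⟫-∘ (a .raw) (f .raw) (OV (Γ .raw)) (g .raw / OV (Δ .raw)) (Elem-vars a)))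
      ; _▹_ = λ Γ A → extend Γ (fresh Γ) A
      ; 𝐩 = λ {Γ} A → projection Γ (fresh Γ) A
      ; 𝐯 = lastVar
      ; pair = pairMor
      ; 𝐩-pair = λ {_} {_} {A} {f} {a} → Mor-≡ (proj∘pair A f a)
      ; 𝐯-pair = λ {_} {Γ} {A} {f} {a} →
          subst-≡ (trans (sym ([⊙]ᵀ A (projection Γ (fresh Γ) A) (pairMor A f a)))
                         (cong (A [_]ᵀ) (Mor-≡ (proj∘pair A f a))))
                  (/-here (f .raw) (OV (Γ .raw)) (a .raw) (fresh Γ .value))
      ; pair-η = λ { {Γ = Γ} {A} k@(mor (f ▸ a) kok) → Mor-≡ (cong₂ (λ s̄ s → s̄ ▸ s)
          (trans (⟪/⟫ᵛ-wk (ids (OV (Γ .raw))) f (OV (Γ .raw)) a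
                          (ids-⊆ (OV (Γ .raw)) id) (fresh-∉ Γ))
                 (ids-/ f (OV (Γ .raw)) (Ctx-distinct Γ)))
          (trans (raw-subst (sym ([⊙]ᵀ A (projection Γ (fresh Γ) A) k)) (lastVar A [ k ]ᵉ))
                 (/-here f (OV (Γ .raw)) a (fresh Γ .value)))) }
      ; pair-∘ = λ {_} {_} {_} {A} f a g → Mor-≡ (cong₂ (λ s̄ s → s̄ ▸ s) refl
          (sym (raw-subst (sym ([⊙]ᵀ A f g)) (a [ g ]ᵉ))))
      }

  data Connective : Set where
    and or imp : Connective

  data Quantifier : Set where
    all ex : Quantifier

  module _ (P : Set) where

    data PreForm : Set where
      rel     : P → List Term → PreForm
      bot top : PreForm
      con     : Connective → PreForm → PreForm → PreForm
      quant   : Quantifier → V → PreType → PreForm → PreForm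

    -- φ{(Δ,Γ,ā)}: every bound variable is renamed to the provided fresh variable of
    -- the current target context, so nothing is captured.
    substForm : ∀ {k n} → PreForm → PreCtx k → PreCtx n → Vec Term n → PreForm
    substForm (rel R ts)      Δ Γ ā = rel R (ts ⟪ ā / OV Γ ⟫*)
    substForm bot             Δ Γ ā = bot
    substForm top             Δ Γ ā = top
    substForm (con c ϕ ψ)     Δ Γ ā = con c (substForm ϕ Δ Γ ā) (substForm ψ Δ Γ ā)
    substForm (quant q x A θ) Δ Γ ā =
      quant q y B (substForm θ (Δ ▸ (y , B)) (Γ ▸ (x , A)) (ā ▸ var y))
      where
      y = fr (Vars Δ)
      B = A ⟪ ā / OV Γ ⟫ᵀ

    record PredDecl : Set where
      field
        {size} : ℕ
        ctx    : PreCtx size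
        idx    : List (Fin size)
        symbol : P

    record PredSignature (Sg : Signature) : Set₁ where
      field
        preds        : Pred PredDecl 0ℓ
        pred-context : ∀ {d} → preds d → Context (Signature.presignature Sg) (PredDecl.ctx d)
        pred-idx     : ∀ {d} → preds d → Determining (PredDecl.ctx d) (PredDecl.idx d)
        pred-unique  : ∀ {d e} → preds d → preds e → PredDecl.symbol d ≡ PredDecl.symbol e → d ≡ e

    module _ {Sg : Signature} (Π : PredSignature Sg) where
      open Signature Sg using () renaming (presignature to 𝓢)
      open PredSignature Π

      data IsForm : ∀ {n} → PreCtx n → PreForm → Set where
        atom  : ∀ {k} {Δ : PreCtx k} {d ā} →
                preds d → IsMor 𝓢 Δ (PredDecl.ctx d) ā →
                IsForm Δ (rel (PredDecl.symbol d) (ā at PredDecl.idx d))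
        bot   : ∀ {n} {Γ : PreCtx n} → Context 𝓢 Γ → IsForm Γ bot
        top   : ∀ {n} {Γ : PreCtx n} → Context 𝓢 Γ → IsForm Γ top
        con   : ∀ {n} {Γ : PreCtx n} {c ϕ ψ} → IsForm Γ ϕ → IsForm Γ ψ → IsForm Γ (con c ϕ ψ)
        quant : ∀ {n} {Γ : PreCtx n} {q x A ϕ} →
                IsType 𝓢 Γ A → IsForm (Γ ▸ (x , A)) ϕ → IsForm Γ (quant q x A ϕ)

      form-context : ∀ {n} {Γ : PreCtx n} {ϕ} → IsForm Γ ϕ → Context 𝓢 Γ
      form-context (atom _ (mor Δok _ _)) = Δok
      form-context (bot Γok)  = Γok
      form-context (top Γok)  = Γok
      form-context (con ϕ _)  = form-context ϕ
      form-context (quant _ ϕ) with R2 Γok _ _ ← form-context ϕ = Γok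

      form-sub : ∀ {k n} {Δ : PreCtx k} {Γ : PreCtx n} {ā ϕ} →
                 IsForm Γ ϕ → IsMor 𝓢 Δ Γ ā → IsForm Δ (substForm ϕ Δ Γ ā)
      form-sub {Δ = Δ} {Γ} {ā} (atom {d = d} {b̄} d∈ b̄ok) āok =
        subst (λ ts → IsForm Δ (rel (PredDecl.symbol d) ts))
              (sym (at-⟪⟫ b̄ (PredDecl.idx d) (ā / OV Γ)))
              (atom d∈ (mor-sub b̄ok āok))
      form-sub (bot _) (mor Δok _ _) = bot Δok
      form-sub (top _) (mor Δok _ _) = top Δok
      form-sub (con ϕ ψ) āok         = con (form-sub ϕ āok) (form-sub ψ āok)
      form-sub (quant A ϕ) āok       =
        quant (type-sub A āok) (form-sub ϕ (mor-lift āok (form-context ϕ)))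

      record Form (Γ : Ctx Sg) : Set where
        constructor form
        field
          raw : PreForm
          ok  : Irrelevant (IsForm (Ctx.raw Γ) raw)

      topᶠ botᶠ : ∀ {Γ} → Form Γ
      topᶠ {Γ} = form top (Irr.map top (Ctx.ok Γ))
      botᶠ {Γ} = form bot (Irr.map bot (Ctx.ok Γ))

      conᶠ : Connective → ∀ {Γ} → Form Γ → Form Γ → Form Γ
      conᶠ c (form ϕ ϕok) (form ψ ψok) = form (con c ϕ ψ) (Irr.zipWith con ϕok ψok)

      infixr 7 _∧ᶠ_
      infixr 6 _∨ᶠ_
      infixr 5 _⊃ᶠ_
      _∧ᶠ_ _∨ᶠ_ _⊃ᶠ_ : ∀ {Γ} → Form Γ → Form Γ → Form Γ
      _∧ᶠ_ = conᶠ and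
      _∨ᶠ_ = conᶠ or
      _⊃ᶠ_ = conᶠ imp

      quantᶠ : Quantifier → ∀ {Γ} (x : FreshVar Sg Γ) (A : Type Sg Γ) →
               Form (extend Sg Γ x A) → Form Γ
      quantᶠ q x A (form ϕ ϕok) =
        form (quant q (x .value) (Type.raw A) ϕ) (Irr.zipWith quant (Type.ok A) ϕok)

      ∀ᶠ ∃ᶠ : ∀ {Γ} (x : FreshVar Sg Γ) (A : Type Sg Γ) → Form (extend Sg Γ x A) → Form Γ
      ∀ᶠ = quantᶠ all
      ∃ᶠ = quantᶠ ex

      infixl 8 _[_]ᶠ
      _[_]ᶠ : ∀ {Δ Γ} → Form Γ → Mor Sg Δ Γ → Form Δ
      _[_]ᶠ {Δ} {Γ} (form ϕ ϕok) f =
        form (substForm ϕ (Ctx.raw Δ) (Ctx.raw Γ) (Mor.raw f)) (Irr.zipWith form-sub ϕok (Mor.ok f))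

      infix 4 _⟹_
      record Sequent : Set where
        constructor _⟹_
        field
          {context}  : Ctx Sg
          antecedent : Form context
          succedent  : Form context

      Theory : Set₁
      Theory = Pred Sequent 0ℓ

      data Thm (𝕋 : Theory) : Sequent → Set where
        axiom : ∀ {s} → 𝕋 s → Thm 𝕋 s
        ax    : ∀ {Γ} {ϕ : Form Γ} → Thm 𝕋 (ϕ ⟹ ϕ)
        cut   : ∀ {Γ} {ϕ θ ψ : Form Γ} → Thm 𝕋 (ϕ ⟹ θ) → Thm 𝕋 (θ ⟹ ψ) → Thm 𝕋 (ϕ ⟹ ψ)

        ∧-E₁ : ∀ {Γ} {θ ψ : Form Γ} → Thm 𝕋 (θ ∧ᶠ ψ ⟹ θ)
        ∧-E₂ : ∀ {Γ} {θ ψ : Form Γ} → Thm 𝕋 (θ ∧ᶠ ψ ⟹ ψ)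
        ∧-I  : ∀ {Γ} {ϕ θ ψ : Form Γ} →
               Thm 𝕋 (ϕ ⟹ θ) → Thm 𝕋 (ϕ ⟹ ψ) → Thm 𝕋 (ϕ ⟹ θ ∧ᶠ ψ)
        ⊤-I  : ∀ {Γ} {ϕ : Form Γ} → Thm 𝕋 (ϕ ⟹ topᶠ)

        ∨-I₁ : ∀ {Γ} {θ ψ : Form Γ} → Thm 𝕋 (θ ⟹ θ ∨ᶠ ψ)
        ∨-I₂ : ∀ {Γ} {θ ψ : Form Γ} → Thm 𝕋 (ψ ⟹ θ ∨ᶠ ψ)
        ∨-E  : ∀ {Γ} {ϕ θ ψ : Form Γ} →
               Thm 𝕋 (θ ⟹ ϕ) → Thm 𝕋 (ψ ⟹ ϕ) → Thm 𝕋 (θ ∨ᶠ ψ ⟹ ϕ)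
        ⊥-E  : ∀ {Γ} {ϕ : Form Γ} → Thm 𝕋 (botᶠ ⟹ ϕ)

        ⊃-I : ∀ {Γ} {ϕ θ ψ : Form Γ} → Thm 𝕋 (θ ∧ᶠ ψ ⟹ ϕ) → Thm 𝕋 (θ ⟹ ψ ⊃ᶠ ϕ)
        ⊃-E : ∀ {Γ} {ϕ θ ψ : Form Γ} → Thm 𝕋 (θ ⟹ ψ ⊃ᶠ ϕ) → Thm 𝕋 (θ ∧ᶠ ψ ⟹ ϕ)

        ∀-I : ∀ {Γ x A} {ϕ : Form Γ} {ψ : Form (extend Sg Γ x A)} →
              Thm 𝕋 (ϕ [ projection Sg Γ x A ]ᶠ ⟹ ψ) → Thm 𝕋 (ϕ ⟹ ∀ᶠ x A ψ)
        ∀-E : ∀ {Γ x A} {ϕ : Form Γ} {ψ : Form (extend Sg Γ x A)} →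
              Thm 𝕋 (ϕ ⟹ ∀ᶠ x A ψ) → Thm 𝕋 (ϕ [ projection Sg Γ x A ]ᶠ ⟹ ψ)
        ∃-E : ∀ {Γ x A} {ϕ : Form Γ} {ψ : Form (extend Sg Γ x A)} →
              Thm 𝕋 (ψ ⟹ ϕ [ projection Sg Γ x A ]ᶠ) → Thm 𝕋 (∃ᶠ x A ψ ⟹ ϕ)
        ∃-I : ∀ {Γ x A} {ϕ : Form Γ} {ψ : Form (extend Sg Γ x A)} →
              Thm 𝕋 (∃ᶠ x A ψ ⟹ ϕ) → Thm 𝕋 (ψ ⟹ ϕ [ projection Sg Γ x A ]ᶠ)

        sub : ∀ {Δ Γ} {ϕ ψ : Form Γ} (f : Mor Sg Δ Γ) →
              Thm 𝕋 (ϕ ⟹ ψ) → Thm 𝕋 (ϕ [ f ]ᶠ ⟹ ψ [ f ]ᶠ)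

      LindenbaumTarski : Theory → RawHyperdoctrine (𝓕 Sg) 0ℓ 0ℓ
      LindenbaumTarski 𝕋 = record
        { Pr = λ Γ → record
          { Carrier = Form Γ
          ; _≤_     = λ ϕ ψ → Thm 𝕋 (ϕ ⟹ ψ)
          ; ⊤ʰ      = topᶠ
          ; ⊥ʰ      = botᶠ
          ; _∧_     = _∧ᶠ_
          ; _∨_     = _∨ᶠ_
          ; _⇒_     = _⊃ᶠ_
          }
        ; _﹛_﹜ = _[_]ᶠ
        ; ∀ʰ    = λ {Γ} → ∀ᶠ (fresh Sg Γ)
        ; ∃ʰ    = λ {Γ} → ∃ᶠ (fresh Sg Γ)
        }

{-# OPTIONS --safe #-}
module Submission where

-- Every law except the functoriality of Pr is a rule of the calculus or holds by
-- unfolding.  For identities, the de Bruijn property forces each bound variable to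
-- be the one substitution would choose; for composites, the two renamings of a
-- bound variable compose because the intermediate one is fresh.

open import Defs
open import Data.Irrelevant using () renaming ([_] to irr)
open import Data.List using (List; _∷_)
open import Data.List.Relation.Binary.Subset.Propositional using (_⊆_)
open import Data.List.Relation.Unary.Any using (here; there)
open import Data.Product using (_×_; _,_; proj₁; uncurry)
open import Data.Unit using (⊤; tt)
open import Data.Vec using (Vec; []; _∷_)
open import Function using (_⇔_; mk⇔; module Equivalence; id; _∘_)
open import Relation.Binary.PropositionalEquality
  using (_≡_; refl; sym; trans; cong; cong₂; isEquivalence)
open import Relation.Nullary using (Dec; yes; recompute)
open import Relation.Nullary.Decidable using (_×-dec_)

open Equivalence using (to; from)

module _ (𝓥 : VariableSystem) (F T : Set) where
  open VariableSystem 𝓥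

  VarsIn-mono : ∀ {n} (ā : Vec (Term 𝓥 F T) n) {X Y} → X ⊆ Y →
                VarsIn 𝓥 F T ā X → VarsIn 𝓥 F T ā Y
  VarsIn-mono []      X⊆Y _         = tt
  VarsIn-mono (ā ▸ a) X⊆Y (ā⊆ , a⊆) = VarsIn-mono ā X⊆Y ā⊆ , X⊆Y ∘ a⊆

  module _ (P : Set) where

    -- The decidable part of IsForm needed for functoriality; unlike a derivation,
    -- it can be recomputed from an irrelevant proof.
    Scoped : List V → PreForm 𝓥 F T P → Set
    Scoped X (rel R ts)      = vars* 𝓥 F T ts ⊆ X
    Scoped X bot             = ⊤
    Scoped X top             = ⊤
    Scoped X (con c ϕ ψ)     = Scoped X ϕ × Scoped X ψ
    Scoped X (quant q x A θ) = fr X ≡ x × varsᵀ 𝓥 F T A ⊆ X × Scoped (x ∷ X) θ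

    scoped? : ∀ X ϕ → Dec (Scoped X ϕ)
    scoped? X (rel R ts)      = _⊆?_ 𝓥 F T (vars* 𝓥 F T ts) X
    scoped? X bot             = yes tt
    scoped? X top             = yes tt
    scoped? X (con c ϕ ψ)     = scoped? X ϕ ×-dec scoped? X ψ
    scoped? X (quant q x A θ) =
      (fr X ≟ x) ×-dec _⊆?_ 𝓥 F T (varsᵀ 𝓥 F T A) X ×-dec scoped? (x ∷ X) θ

    -- Substitution renames every bound variable to `fr` of the target context. `Scoped` says that
    -- it already has this name, so extending the identity under a binder gives the identity again.
    substForm-id : ∀ {n} ϕ (Γ : PreCtx 𝓥 F T n) → Scoped (Vars 𝓥 F T Γ) ϕ →
                   substForm 𝓥 F T P ϕ Γ Γ (ids 𝓥 F T (OV 𝓥 F T Γ)) ≡ ϕ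
    substForm-id (rel R ts)      Γ _         = cong (rel R) (⟪ids⟫* 𝓥 F T ts (OV 𝓥 F T Γ))
    substForm-id bot             Γ _         = refl
    substForm-id top             Γ _         = refl
    substForm-id (con c ϕ ψ)     Γ (ϕ⊆ , ψ⊆) =
      cong₂ (con c) (substForm-id ϕ Γ ϕ⊆) (substForm-id ψ Γ ψ⊆)
    -- Matching on `refl` identifies `x` with the chosen variable. The rewrite then makes the two
    -- extended contexts coincide, as the induction hypothesis requires.
    substForm-id (quant q x A θ) Γ (refl , _ , θ⊆)
      rewrite ⟪ids⟫ᵀ 𝓥 F T A (OV 𝓥 F T Γ) = cong (quant q x A) (substForm-id θ (Γ ▸ (x , A)) θ⊆)

    -- Working on raw syntax lets the induction pass under binders without derivations. At a
    -- quantifier both sides bind the variable fresh for `Θ`; the name chosen for `Δ` is only a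
    -- stopover.
    substForm-∘ : ∀ {k m n} ϕ (Θ : PreCtx 𝓥 F T k) (Δ : PreCtx 𝓥 F T m) (Γ : PreCtx 𝓥 F T n) ā b̄ →
                  Scoped (Vars 𝓥 F T Γ) ϕ → VarsIn 𝓥 F T ā (Vars 𝓥 F T Δ) →
                  substForm 𝓥 F T P ϕ Θ Γ (_⟪_⟫ᵛ 𝓥 F T ā (_/_ 𝓥 F T b̄ (OV 𝓥 F T Δ)))
                  ≡ substForm 𝓥 F T P (substForm 𝓥 F T P ϕ Δ Γ ā) Θ Δ b̄
    substForm-∘ (rel R ts) Θ Δ Γ ā b̄ ts⊆ _ =
      cong (rel R) (sym (⟪/⟫*-∘ 𝓥 F T ts ā (OV 𝓥 F T Γ) _ ts⊆))
    substForm-∘ bot Θ Δ Γ ā b̄ _ _ = refl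
    substForm-∘ top Θ Δ Γ ā b̄ _ _ = refl
    substForm-∘ (con c ϕ ψ) Θ Δ Γ ā b̄ (ϕ⊆ , ψ⊆) ā⊆ =
      cong₂ (con c) (substForm-∘ ϕ Θ Δ Γ ā b̄ ϕ⊆ ā⊆) (substForm-∘ ψ Θ Δ Γ ā b̄ ψ⊆ ā⊆)
    substForm-∘ (quant q x A θ) Θ Δ Γ ā b̄ (_ , A⊆ , θ⊆) ā⊆
      -- Turns the type of the bound variable on the right, `B` under `b̄`, into `C`, so that both
      -- bodies live over `Θ ▸ (z , C)`.
      rewrite ⟪/⟫ᵀ-∘ 𝓥 F T A ā (OV 𝓥 F T Γ) (_/_ 𝓥 F T b̄ (OV 𝓥 F T Δ)) A⊆ =
      cong (quant q z C) (trans
        (cong (substForm 𝓥 F T P θ (Θ ▸ (z , C)) (Γ ▸ (x , A))) (sym lift-∘))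
        (substForm-∘ θ (Θ ▸ (z , C)) (Δ ▸ (y , B)) (Γ ▸ (x , A)) (ā ▸ var y) (b̄ ▸ var z) θ⊆
                     (VarsIn-mono ā there ā⊆ , λ { (here refl) → here refl })))
      where
      y = fr (Vars 𝓥 F T Δ)
      z = fr (Vars 𝓥 F T Θ)
      B = _⟪_⟫ᵀ 𝓥 F T A (_/_ 𝓥 F T ā (OV 𝓥 F T Γ))
      C = _⟪_⟫ᵀ 𝓥 F T A
            (_/_ 𝓥 F T (_⟪_⟫ᵛ 𝓥 F T ā (_/_ 𝓥 F T b̄ (OV 𝓥 F T Δ))) (OV 𝓥 F T Γ))
      -- By `ā⊆` and freshness `y` does not occur in `ā`, so the extra assignment of `z` to `y` acts
      -- on the last component only.
      lift-∘ : _⟪_⟫ᵛ 𝓥 F T (ā ▸ var y) (_/_ 𝓥 F T (b̄ ▸ var z) (OV 𝓥 F T Δ ▸ y))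
               ≡ (_⟪_⟫ᵛ 𝓥 F T ā (_/_ 𝓥 F T b̄ (OV 𝓥 F T Δ)) ▸ var z)
      lift-∘ = cong₂ (λ s̄ s → s̄ ▸ s)
        (⟪/⟫ᵛ-wk 𝓥 F T ā b̄ (OV 𝓥 F T Δ) (var z) ā⊆ (φ-fresh (fr-φ (Vars 𝓥 F T Δ))))
        (/-here 𝓥 F T b̄ (OV 𝓥 F T Δ) (var z) y)

    module _ {Sg : Signature 𝓥 F T} (Π : PredSignature 𝓥 F T P Sg) where

      Form-≡ : ∀ {Γ} {ϕ ψ : Form 𝓥 F T P Π Γ} → Form.raw ϕ ≡ Form.raw ψ → ϕ ≡ ψ
      Form-≡ {ϕ = form _ _} {form _ _} refl = refl

      -- The de Bruijn property enters here: the context derivation of the body puts the bound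
      -- variable in `φ`, whose only member is `fr`.
      form-scoped : DeBruijn 𝓥 → ∀ {n} {Γ : PreCtx 𝓥 F T n} {ϕ} →
                    IsForm 𝓥 F T P Π Γ ϕ → Scoped (Vars 𝓥 F T Γ) ϕ
      form-scoped db (atom {d = d} {ā} _ āok) =
        at-vars 𝓥 F T {Signature.presignature Sg} ā (PredDecl.idx d) (mor-vars 𝓥 F T āok)
      form-scoped db (bot _)       = tt
      form-scoped db (top _)       = tt
      form-scoped db (con ϕ ψ)     = form-scoped db ϕ , form-scoped db ψ
      form-scoped db (quant A ϕ) with R2 _ _ x∈φ ← form-context 𝓥 F T P Π ϕ =
        proj₁ (db _) x∈φ , type-vars 𝓥 F T A , form-scoped db ϕ

      Form-scoped : DeBruijn 𝓥 → ∀ {Γ} (ϕ : Form 𝓥 F T P Π Γ) →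
                    Scoped (Vars 𝓥 F T (Ctx.raw Γ)) (Form.raw ϕ)
      Form-scoped db {Γ} (form ϕ (irr ϕok)) =
        recompute (scoped? (Vars 𝓥 F T (Ctx.raw Γ)) ϕ) (form-scoped db ϕok)

      open Cwf (𝓕 𝓥 F T Sg) using (lift; 𝐩; _[_])

      -- Both sides bind the same variable at the same type. They differ only in how the
      -- substitution for the body is built: by appending `var y`, or by the cwf operation `lift`.
      quant-stable : ∀ q {Δ Γ} (S : Type 𝓥 F T Sg Γ)
                     (R : Form 𝓥 F T P Π (extend 𝓥 F T Sg Γ (fresh 𝓥 F T Sg Γ) S))
                     (f : Mor 𝓥 F T Sg Δ Γ) →
                     _[_]ᶠ 𝓥 F T P Π (quantᶠ 𝓥 F T P Π q (fresh 𝓥 F T Sg Γ) S R) f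
                     ≡ quantᶠ 𝓥 F T P Π q (fresh 𝓥 F T Sg Δ) (S [ f ])
                         (_[_]ᶠ 𝓥 F T P Π R (lift f S))
      quant-stable q {Δ} {Γ} S R f = Form-≡
        (cong (λ ā → quant q y B (substForm 𝓥 F T P (Form.raw R)
                                   (Ctx.raw Δ ▸ (y , B)) (Ctx.raw Γ ▸ (x , Type.raw S)) ā))
              (sym lift-raw))
        where
        x = fr (Vars 𝓥 F T (Ctx.raw Γ))
        y = fr (Vars 𝓥 F T (Ctx.raw Δ))
        B = Type.raw (S [ f ])
        lift-raw : Mor.raw (lift f S) ≡ (Mor.raw f ▸ var y)
        -- Composing with the projection substitutes variables for themselves, and transporting the
        -- last variable between equal types leaves its raw term alone.
        lift-raw = cong₂ (λ s̄ s → s̄ ▸ s)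
          (⟪ids⟫ᵛ 𝓥 F T (Mor.raw f) (OV 𝓥 F T (Ctx.raw Δ)))
          (raw-subst 𝓥 F T Sg (sym ([⊙]ᵀ 𝓥 F T Sg S f (𝐩 (S [ f ])))) (lastVar 𝓥 F T Sg (S [ f ])))

      module _ (𝕋 : Theory 𝓥 F T P Π) where

        infix 3 ⊢_
        ⊢_ : Sequent 𝓥 F T P Π → Set
        ⊢_ = Thm 𝓥 F T P Π 𝕋

        module _ {Γ : Ctx 𝓥 F T Sg} (x : FreshVar 𝓥 F T Sg Γ) (A : Type 𝓥 F T Sg Γ) where
          private
            Γx = extend 𝓥 F T Sg Γ x A

            ∀ₓ ∃ₓ : Form 𝓥 F T P Π Γx → Form 𝓥 F T P Π Γ
            ∀ₓ = ∀ᶠ 𝓥 F T P Π x A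
            ∃ₓ = ∃ᶠ 𝓥 F T P Π x A

            wk : Form 𝓥 F T P Π Γ → Form 𝓥 F T P Π Γx
            wk ϕ = _[_]ᶠ 𝓥 F T P Π ϕ (projection 𝓥 F T Sg Γ x A)

          ∀ᶠ-adjoint : ∀ ϕ ψ → (⊢ ϕ ⟹ ∀ₓ ψ) ⇔ (⊢ wk ϕ ⟹ ψ)
          ∀ᶠ-adjoint ϕ ψ = mk⇔ (∀-E {x = x} {A} {ϕ} {ψ}) (∀-I {x = x} {A} {ϕ} {ψ})

          ∃ᶠ-adjoint : ∀ ϕ ψ → (⊢ ∃ₓ ψ ⟹ ϕ) ⇔ (⊢ ψ ⟹ wk ϕ)
          ∃ᶠ-adjoint ϕ ψ = mk⇔ (∃-I {x = x} {A} {ϕ} {ψ}) (∃-E {x = x} {A} {ϕ} {ψ})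

          -- The counit of the adjunction, obtained from `ax`, is cut with `p` and transposed back.
          ∀ᶠ-monotone : ∀ {ψ ψ′} → ⊢ ψ ⟹ ψ′ → ⊢ ∀ₓ ψ ⟹ ∀ₓ ψ′
          ∀ᶠ-monotone {ψ} {ψ′} p =
            from (∀ᶠ-adjoint (∀ₓ ψ) ψ′) (cut (to (∀ᶠ-adjoint (∀ₓ ψ) ψ) ax) p)

          -- Dually, `p` is cut with the unit at `ψ′`.
          ∃ᶠ-monotone : ∀ {ψ ψ′} → ⊢ ψ ⟹ ψ′ → ⊢ ∃ₓ ψ ⟹ ∃ₓ ψ′
          ∃ᶠ-monotone {ψ} {ψ′} p =
            from (∃ᶠ-adjoint (∃ₓ ψ′) ψ) (cut p (to (∃ᶠ-adjoint (∃ₓ ψ′) ψ′) ax))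

        LindenbaumTarski-isFirstOrderHyperdoctrine :
          DeBruijn 𝓥 →
          IsFirstOrderHyperdoctrine (LindenbaumTarski 𝓥 F T P Π 𝕋)
        LindenbaumTarski-isFirstOrderHyperdoctrine db = record
          { Pr-heyting = λ Γ → record
            { isPreorder = record
              { isEquivalence = isEquivalence
              ; reflexive     = λ { refl → ax }
              ; trans         = cut
              }
            ; ⊥-least    = λ _ → ⊥-E
            ; ⊤-greatest = λ _ → ⊤-I
            ; ∧-meet     = λ x y _ → mk⇔
                (λ p → cut p (∧-E₁ {θ = x} {y}) , cut p (∧-E₂ {θ = x} {y})) (uncurry ∧-I)
            ; ∨-join     = λ x y _ → mk⇔
                (λ p → cut (∨-I₁ {θ = x} {y}) p , cut (∨-I₂ {θ = x} {y}) p) (uncurry ∨-E)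
            ; ⇒-residual = λ x y z → mk⇔ (⊃-E {ϕ = y} {z} {x}) (⊃-I {ϕ = y} {z} {x})
            }
          ; Pr-morphism = λ f → record
            { monotone = sub f
            -- `substForm` computes through the connectives and derivations are irrelevant, so these
            -- equalities are definitional.
            ; ⊤-homo   = refl
            ; ⊥-homo   = refl
            ; ∧-homo   = λ _ _ → refl
            ; ∨-homo   = λ _ _ → refl
            ; ⇒-homo   = λ _ _ → refl
            }
          ; Pr-id = λ {Γ} R → Form-≡ (substForm-id (Form.raw R) (Ctx.raw Γ) (Form-scoped db R))
          ; Pr-∘ = λ {Θ} {Δ} {Γ} R f g → Form-≡
              (substForm-∘ (Form.raw R) (Ctx.raw Θ) (Ctx.raw Δ) (Ctx.raw Γ) (Mor.raw f) (Mor.raw g)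
                           (Form-scoped db R) (Mor-vars 𝓥 F T Sg f))
          ; ∀-monotone = λ {Γ} {S} → ∀ᶠ-monotone (fresh 𝓥 F T Sg Γ) S
          ; ∃-monotone = λ {Γ} {S} → ∃ᶠ-monotone (fresh 𝓥 F T Sg Γ) S
          ; ∀-adjoint  = λ {Γ} {S} → ∀ᶠ-adjoint (fresh 𝓥 F T Sg Γ) S
          ; ∃-adjoint  = λ {Γ} {S} → ∃ᶠ-adjoint (fresh 𝓥 F T Sg Γ) S
          ; ∀-stable   = λ {_} {_} {S} → quant-stable all S
          ; ∃-stable   = λ {_} {_} {S} → quant-stable ex S
          }

mainTheorem17 : (𝓥 : VariableSystem) → DeBruijn 𝓥 →
    (F T P : Set) (Sg : Signature 𝓥 F T) (Π : PredSignature 𝓥 F T P Sg)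
    (𝕋 : Theory 𝓥 F T P Π) →
    let H = LindenbaumTarski 𝓥 F T P Π 𝕋 in
    IsFirstOrderHyperdoctrine H
    × (∀ {Γ} (ϕ ψ : Form 𝓥 F T P Π Γ) →
    RawHyperdoctrine.Pr._≤_ H Γ ϕ ψ ⇔ Thm 𝓥 F T P Π 𝕋 (ϕ ⟹ ψ))
mainTheorem17 𝓥 db F T P Sg Π 𝕋 =
  -- The order is derivability by definition, hence the identity in both directions.
  LindenbaumTarski-isFirstOrderHyperdoctrine 𝓥 F T P Π 𝕋 db , λ _ _ → mk⇔ id id
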